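{- Let $n\ge 0$, let $A\in\mathcal{PM}(n)$ and let $v\in\{0,1\}^n$ be a row vector. Then $v$ is a poset vector of $A$ if and only if $\mathrm{supp}(v)$ is an order ideal of $P_A$. Moreover, the map $v\mapsto \mathrm{supp}(v)$ is a bijection between the set of poset vectors of $A$ (equivalently, the set of $v$-extensions $A^v$ of $A$) and the set of order ideals of $P_A$.
   Context: Let $X_n=\{0,1,\ldots,n-1\}$. A naturally labeled (NL) poset on $X_n$ is a partial order $\preceq$ on $X_n$ such that $x\preceq y$ implies $x\le y$ in the usual integer order. Its poset matrix is the $n\times n$ $(0,1)$-matrix $A=(a_{i,j})_{i,j\in X_n}$ (indices starting from $0$) with $a_{i,j}=1$ if $j\preceq i$ and $a_{i,j}=0$ otherwise. $\mathcal{PM}(n)$ denotes the set of poset matrices of NL posets on $X_n$, and for $A\in\mathcal{PM}(n)$, $P_A$ is the unique NL poset on $X_n$ whose poset matrix is $A$. For a row vector $v\in\{0,1\}^n$, the $v$-extension of $A$ is the $(n+1)\times(n+1)$ matrix $A^v=\begin{bmatrix}A&\mathbf{0}\\ v&1\end{bmatrix}$, and $v$ is called a poset vector of $A$ if $A^v\in\mathcal{PM}(n+1)$. $\mathrm{supp}(v)=\{j\in X_n: v_j=1\}$. An order ideal of a poset is a downward closed subset (the empty set included). -}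

module Defs where

open import Data.Bool using (if_then_else_)
open import Data.Digit using (Bit; 0b; 1b)
open import Data.Fin using (Fin; _≤_; _≟_)
open import Data.Fin.Subset using (Subset; _∈_)
open import Data.Nat using (ℕ; suc)
open import Data.Product using (Σ; Σ-syntax; ∃-syntax; _×_; _,_; proj₁)
open import Data.Vec using (Vec; lookup; map; tabulate; _∷ʳ_)
open import Data.Vec.Properties using (lookup∘tabulate)
open import Function.Bundles using (_⇔_; mk⇔; module Equivalence)
open import Level using (Level; 0ℓ)
open import Relation.Binary.Bundles using (Setoid)
open import Relation.Binary.Core using (Rel)
open import Relation.Binary.Structures using (IsDecPartialOrder)
open import Relation.Binary.PropositionalEquality using (_≡_; refl; sym; trans; cong; setoid)
open import Relation.Nullary using (Dec; does; yes; no)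
import Relation.Binary.Construct.On as On

private
  variable
    ℓ : Level
    m n : ℕ

Matrix : ℕ → ℕ → Set
Matrix m n = Vec (Vec Bit n) m

entry : Matrix m n → Fin m → Fin n → Bit
entry A i j = lookup (lookup A i) j

-- The order is required to be decidable, so that its (0,1)-matrix exists
-- constructively; classically this is no restriction.
record NLPoset (n : ℕ) : Set₁ where
  infix 4 _≼_
  field
    _≼_               : Rel (Fin n) 0ℓ
    isDecPartialOrder : IsDecPartialOrder _≡_ _≼_
    natural           : ∀ {x y} → x ≼ y → x ≤ y

  open IsDecPartialOrder isDecPartialOrder public
    using () renaming (_≤?_ to _≼?_)

posetMatrix : NLPoset n → Matrix n n
posetMatrix P = tabulate λ i → tabulate λ j →
  if does (j ≼? i) then 1b else 0b
  where open NLPoset P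

PM : (n : ℕ) → Matrix n n → Set₁
PM n A = Σ[ P ∈ NLPoset n ] posetMatrix P ≡ A

-- P_A.  It is extracted from the membership proof; by P[]-unique below the
-- order does not depend on which proof is used.
P[_] : {A : Matrix n n} → PM n A → NLPoset n
P[_] = proj₁

entry-posetMatrix : (P : NLPoset n) → let open NLPoset P in
  ∀ i j → entry (posetMatrix P) i j ≡ 1b ⇔ j ≼ i
entry-posetMatrix {n} P i j = mk⇔ (λ e → from1 (j ≼? i) (trans (sym eq) e))
                                  (λ r → trans eq (to1 (j ≼? i) r))
  where
  open NLPoset P

  eq : entry (posetMatrix P) i j ≡ (if does (j ≼? i) then 1b else 0b)
  eq = trans (cong (λ row → lookup row j) (lookup∘tabulate _ i))
             (lookup∘tabulate _ j)

  from1 : {R : Set} (d : Dec R) → (if does d then 1b else 0b) ≡ 1b → R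
  from1 (yes r) _ = r

  to1 : {R : Set} (d : Dec R) → R → (if does d then 1b else 0b) ≡ 1b
  to1 (yes _) _ = refl
  to1 (no ¬r) r with () ← ¬r r

P[]-unique : {A : Matrix n n} (p q : PM n A) →
  ∀ x y → NLPoset._≼_ P[ p ] x y ⇔ NLPoset._≼_ P[ q ] x y
P[]-unique (P , refl) (Q , e) x y = mk⇔
  (λ r → E.to Q (trans (cong (λ M → entry M y x) e) (E.from P r)))
  (λ r → E.to P (trans (cong (λ M → entry M y x) (sym e)) (E.from Q r)))
  where
  module E (R : NLPoset _) = Equivalence (entry-posetMatrix R y x)

infix 8 _^_

_^_ : Matrix n n → Vec Bit n → Matrix (suc n) (suc n)
A ^ v = map (_∷ʳ 0b) A ∷ʳ (v ∷ʳ 1b)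

IsPosetVector : Matrix n n → Vec Bit n → Set₁
IsPosetVector {n} A v = PM (suc n) (A ^ v)

IsPosetExtension : Matrix n n → Matrix (suc n) (suc n) → Set₁
IsPosetExtension A B = ∃[ v ] IsPosetVector A v × B ≡ A ^ v

supp : Vec Bit n → Subset n
supp v = tabulate λ j → does (lookup v j ≟ 1b)

IsOrderIdeal : NLPoset n → Subset n → Set
IsOrderIdeal P I = ∀ {x y} → x ≼ y → y ∈ I → x ∈ I
  where open NLPoset P

-- The set { x | Q x }: two elements are equal when the underlying x's are,
-- regardless of the proofs of Q.
⟪_⟫ : {X : Set} → (X → Set ℓ) → Setoid ℓ 0ℓ
⟪_⟫ {X = X} Q = On.setoid {B = Σ X Q} (setoid X) proj₁

PosetVectors : Matrix n n → Setoid _ _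
PosetVectors A = ⟪ IsPosetVector A ⟫

PosetExtensions : Matrix n n → Setoid _ _
PosetExtensions A = ⟪ IsPosetExtension A ⟫

OrderIdeals : NLPoset n → Setoid _ _
OrderIdeals P = ⟪ IsOrderIdeal P ⟫

{-# OPTIONS --safe #-}

-- A square (0,1)-matrix B is a poset matrix exactly when the relation
-- "B has a 1 at (j , i)" is reflexive, transitive and contained in i ≤ j
-- (antisymmetry is then automatic).  For A ^ v all instances of these
-- conditions are inherited from A, except transitivity along x ≼ y ≼ n with
-- x , y < n and n the new top index, which says that supp v is downward closed.

module Submission where

open import Defs
open import Data.Bool using (true; false; if_then_else_)
open import Data.Digit using (Bit; 0b; 1b)
open import Data.Fin using (Fin; zero; suc; fromℕ; inject₁; _≤_; _≟_)
open import Data.Fin.Properties using (≤-antisym; ≤fromℕ; toℕ-inject₁)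
open import Data.Fin.Relation.Unary.Top using (view; ‵fromℕ; ‵inject₁)
open import Data.Fin.Subset using (Subset; _∈_)
open import Data.Nat using (ℕ)
open import Data.Product using (Σ-syntax; _×_; _,_; proj₁)
open import Data.Vec using (Vec; []; _∷_; _∷ʳ_; lookup; map)
open import Data.Vec.Properties using (lookup-map; lookup∘tabulate; tabulate∘lookup; tabulate-cong; []=⇒lookup; lookup⇒[]=; ∷ʳ-injectiveˡ; ∷ʳ-injectiveʳ)
open import Function.Bundles using (_⇔_; mk⇔; Bijection; module Equivalence)
open import Function.Construct.Composition using (_⇔-∘_)
open import Relation.Binary.PropositionalEquality using (_≡_; refl; sym; trans; cong; subst; isEquivalence)
open import Relation.Binary.Structures using (IsDecPartialOrder)
open import Relation.Nullary using (Dec; does; yes)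
open import Relation.Nullary.Decidable using (dec-true)

private
  variable
    X : Set
    n : ℕ

lookup-∷ʳ-inject₁ : ∀ (xs : Vec X n) x i → lookup (xs ∷ʳ x) (inject₁ i) ≡ lookup xs i
lookup-∷ʳ-inject₁ (_ ∷ _)  x zero    = refl
lookup-∷ʳ-inject₁ (_ ∷ xs) x (suc i) = lookup-∷ʳ-inject₁ xs x i

lookup-∷ʳ-fromℕ : ∀ (xs : Vec X n) x → lookup (xs ∷ʳ x) (fromℕ n) ≡ x
lookup-∷ʳ-fromℕ []       x = refl
lookup-∷ʳ-fromℕ (_ ∷ xs) x = lookup-∷ʳ-fromℕ xs x

lookup-injective : {xs ys : Vec X n} → (∀ i → lookup xs i ≡ lookup ys i) → xs ≡ ys
lookup-injective {xs = xs} {ys} eq =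
  trans (sym (tabulate∘lookup xs)) (trans (tabulate-cong eq) (tabulate∘lookup ys))

-- A bit is determined by whether it equals `1b`, so equalities of matrices and vectors reduce to
-- equivalences of relations.
≡1b-ext : {a b : Bit} → a ≡ 1b ⇔ b ≡ 1b → a ≡ b
≡1b-ext {zero}     {zero}     _ = refl
≡1b-ext {zero}     {suc zero} e with () ← Equivalence.from e refl
≡1b-ext {suc zero} {_}        e = sym (Equivalence.to e refl)

-- Indices are swapped because row i of a poset matrix lists the elements below i.
infix 4 _≼⟨_⟩_

_≼⟨_⟩_ : Fin n → Matrix n n → Fin n → Set
i ≼⟨ B ⟩ j = entry B j i ≡ 1b

-- Membership in `PM` restated on entries, so that it can be checked by cases on the indices without
-- handling a bundled order.
record IsNLMatrix (B : Matrix n n) : Set where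
  field
    ≼-refl    : ∀ i → i ≼⟨ B ⟩ i
    ≼-trans   : ∀ i j k → i ≼⟨ B ⟩ j → j ≼⟨ B ⟩ k → i ≼⟨ B ⟩ k
    ≼-natural : ∀ i j → i ≼⟨ B ⟩ j → i ≤ j

PM⇒≼⇔ : {B : Matrix n n} (p : PM n B) → ∀ i j → i ≼⟨ B ⟩ j ⇔ NLPoset._≼_ P[ p ] i j
PM⇒≼⇔ (P , refl) i j = entry-posetMatrix P j i

PM⇒IsNLMatrix : {B : Matrix n n} → PM n B → IsNLMatrix B
PM⇒IsNLMatrix p = record
  { ≼-refl    = λ i → from i i O.refl
  ; ≼-trans   = λ i j k i≼j j≼k → from i k (O.trans (to i j i≼j) (to j k j≼k))
  ; ≼-natural = λ i j i≼j → NLPoset.natural P[ p ] (to i j i≼j)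
  }
  where
  module O = IsDecPartialOrder (NLPoset.isDecPartialOrder P[ p ])
  module E i j = Equivalence (PM⇒≼⇔ p i j)
  open E using (to; from)

IsNLMatrix⇒PM : {B : Matrix n n} → IsNLMatrix B → PM n B
IsNLMatrix⇒PM {n} {B} nl = P , lookup-injective λ i → lookup-injective λ j →
  ≡1b-ext (entry-posetMatrix P i j)
  where
  open IsNLMatrix nl

  P : NLPoset n
  P = record
    { _≼_ = _≼⟨ B ⟩_
    ; isDecPartialOrder = record
      { isPartialOrder = record
        { isPreorder = record
          { isEquivalence = isEquivalence
          ; reflexive     = λ { refl → ≼-refl _ }
          ; trans         = ≼-trans _ _ _
          }
        -- Naturality turns the two relations into opposite integer inequalities.
        ; antisym = λ i≼j j≼i → ≤-antisym (≼-natural _ _ i≼j) (≼-natural _ _ j≼i)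
        }
      ; _≟_  = _≟_
      ; _≤?_ = λ i j → entry B j i ≟ 1b
      }
    ; natural = ≼-natural _ _
    }

module _ (A : Matrix n n) (v : Vec Bit n) where

  private
    row-inject₁ : ∀ i → lookup (A ^ v) (inject₁ i) ≡ lookup A i ∷ʳ 0b
    row-inject₁ i = trans (lookup-∷ʳ-inject₁ (map (_∷ʳ 0b) A) (v ∷ʳ 1b) i)
                          (lookup-map i (_∷ʳ 0b) A)

    row-fromℕ : lookup (A ^ v) (fromℕ n) ≡ v ∷ʳ 1b
    row-fromℕ = lookup-∷ʳ-fromℕ (map (_∷ʳ 0b) A) (v ∷ʳ 1b)

  entry-^-inject₁-inject₁ : ∀ i j → entry (A ^ v) (inject₁ i) (inject₁ j) ≡ entry A i j
  entry-^-inject₁-inject₁ i j rewrite row-inject₁ i = lookup-∷ʳ-inject₁ (lookup A i) 0b j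

  entry-^-inject₁-fromℕ : ∀ i → entry (A ^ v) (inject₁ i) (fromℕ n) ≡ 0b
  entry-^-inject₁-fromℕ i rewrite row-inject₁ i = lookup-∷ʳ-fromℕ (lookup A i) 0b

  entry-^-fromℕ-inject₁ : ∀ j → entry (A ^ v) (fromℕ n) (inject₁ j) ≡ lookup v j
  entry-^-fromℕ-inject₁ j rewrite row-fromℕ = lookup-∷ʳ-inject₁ v 1b j

  entry-^-fromℕ-fromℕ : entry (A ^ v) (fromℕ n) (fromℕ n) ≡ 1b
  entry-^-fromℕ-fromℕ rewrite row-fromℕ = lookup-∷ʳ-fromℕ v 1b

-- The last row of `A ^ v` is `v` followed by `1b`, so `v` can be read off from the extension.
^-injective : (A : Matrix n n) {v w : Vec Bit n} → A ^ v ≡ A ^ w → v ≡ w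
^-injective A {v} {w} eq =
  ∷ʳ-injectiveˡ v w (∷ʳ-injectiveʳ (map (_∷ʳ 0b) A) (map (_∷ʳ 0b) A) eq)

-- The ideal condition on `supp v`, phrased through entries of `A` so that it involves no choice of
-- poset.
DownClosed : Matrix n n → Vec Bit n → Set
DownClosed A v = ∀ i j → i ≼⟨ A ⟩ j → lookup v j ≡ 1b → lookup v i ≡ 1b

module _ {A : Matrix n n} {v : Vec Bit n} where

  ^-IsNLMatrix⇒DownClosed : IsNLMatrix (A ^ v) → DownClosed A v
  ^-IsNLMatrix⇒DownClosed nl i j i≼j vj =
    trans (sym (entry-^-fromℕ-inject₁ A v i))
          (IsNLMatrix.≼-trans nl (inject₁ i) (inject₁ j) (fromℕ n)
            (trans (entry-^-inject₁-inject₁ A v j i) i≼j)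
            (trans (entry-^-fromℕ-inject₁ A v j) vj))

  DownClosed⇒^-IsNLMatrix : IsNLMatrix A → DownClosed A v → IsNLMatrix (A ^ v)
  DownClosed⇒^-IsNLMatrix nl dc = record
    { ≼-refl = refl′ ; ≼-trans = trans′ ; ≼-natural = natural′ }
    where
    open IsNLMatrix nl

    drop : ∀ {i j} → inject₁ i ≼⟨ A ^ v ⟩ inject₁ j → i ≼⟨ A ⟩ j
    drop {i} {j} = trans (sym (entry-^-inject₁-inject₁ A v j i))

    dropTop : ∀ {i} → inject₁ i ≼⟨ A ^ v ⟩ fromℕ n → lookup v i ≡ 1b
    dropTop {i} = trans (sym (entry-^-fromℕ-inject₁ A v i))

    -- The last column of `A ^ v` is `0b` above the corner, so the hypothesis would give `0b ≡ 1b`.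
    -- The target `Y` is arbitrary, to close any impossible case below.
    top⋠inject₁ : ∀ {i} {Y : Set} → fromℕ n ≼⟨ A ^ v ⟩ inject₁ i → Y
    top⋠inject₁ {i} e with () ← trans (sym (entry-^-inject₁-fromℕ A v i)) e

    refl′ : ∀ i → i ≼⟨ A ^ v ⟩ i
    refl′ i with view i
    ... | ‵fromℕ     = entry-^-fromℕ-fromℕ A v
    ... | ‵inject₁ i = trans (entry-^-inject₁-inject₁ A v i i) (≼-refl i)

    trans′ : ∀ i j k → i ≼⟨ A ^ v ⟩ j → j ≼⟨ A ^ v ⟩ k → i ≼⟨ A ^ v ⟩ k
    trans′ i j k i≼j j≼k with view i | view j | view k
    -- Here `j` and `k` coincide, so the first hypothesis is the goal.
    ... | _          | ‵fromℕ     | ‵fromℕ     = i≼j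
    ... | _          | ‵fromℕ     | ‵inject₁ _ = top⋠inject₁ j≼k
    ... | ‵fromℕ     | ‵inject₁ _ | _          = top⋠inject₁ i≼j
    -- The one case where down-closedness enters.
    ... | ‵inject₁ i | ‵inject₁ j | ‵fromℕ     =
      trans (entry-^-fromℕ-inject₁ A v i) (dc i j (drop i≼j) (dropTop j≼k))
    ... | ‵inject₁ i | ‵inject₁ j | ‵inject₁ k =
      trans (entry-^-inject₁-inject₁ A v k i) (≼-trans i j k (drop i≼j) (drop j≼k))

    natural′ : ∀ i j → i ≼⟨ A ^ v ⟩ j → i ≤ j
    natural′ i j i≼j with view i | view j
    ... | _          | ‵fromℕ     = ≤fromℕ _
    ... | ‵fromℕ     | ‵inject₁ _ = top⋠inject₁ i≼j
    -- `_≤_` on `Fin` compares values under `toℕ`, which `inject₁` preserves.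
    ... | ‵inject₁ i | ‵inject₁ j
      rewrite toℕ-inject₁ i | toℕ-inject₁ j = ≼-natural i j (drop i≼j)

∈-supp⇔ : (v : Vec Bit n) → ∀ x → x ∈ supp v ⇔ lookup v x ≡ 1b
∈-supp⇔ v x = mk⇔
  (λ x∈ → invert (lookup v x ≟ 1b) (trans (sym lookup-supp) ([]=⇒lookup x∈)))
  (λ vx → lookup⇒[]= x (supp v) (trans lookup-supp (dec-true (lookup v x ≟ 1b) vx)))
  where
  lookup-supp : lookup (supp v) x ≡ does (lookup v x ≟ 1b)
  lookup-supp = lookup∘tabulate _ x

  invert : {R : Set} (d : Dec R) → does d ≡ true → R
  invert (yes r) _ = r

supp-injective : {v w : Vec Bit n} → supp v ≡ supp w → v ≡ w
supp-injective {v = v} {w} eq = lookup-injective λ x → ≡1b-ext (mk⇔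
  (λ vx → to w x (subst (x ∈_) eq (from v x vx)))
  (λ wx → to v x (subst (x ∈_) (sym eq) (from w x wx))))
  where
  module E u x = Equivalence (∈-supp⇔ u x)
  open E using (to; from)

-- The inverse of `supp`, supplying the preimages for surjectivity.
indicator : Subset n → Vec Bit n
indicator = map λ b → if b then 1b else 0b

supp-indicator : (I : Subset n) → supp (indicator I) ≡ I
supp-indicator []          = refl
supp-indicator (true  ∷ I) = cong (true ∷_) (supp-indicator I)
supp-indicator (false ∷ I) = cong (false ∷_) (supp-indicator I)

module _ {A : Matrix n n} (A∈PM : PM n A) where

  DownClosed⇔IsOrderIdeal : (v : Vec Bit n) → DownClosed A v ⇔ IsOrderIdeal P[ A∈PM ] (supp v)
  DownClosed⇔IsOrderIdeal v = mk⇔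
    (λ dc {x} {y} x≼y y∈ → S.from x (dc x y (O.from x y x≼y) (S.to y y∈)))
    (λ I-ideal i j i≼j vj → S.to i (I-ideal (O.to i j i≼j) (S.from j vj)))
    where
    module S x   = Equivalence (∈-supp⇔ v x)
    module O x y = Equivalence (PM⇒≼⇔ A∈PM x y)

  IsPosetVector⇔IsOrderIdeal : (v : Vec Bit n) → IsPosetVector A v ⇔ IsOrderIdeal P[ A∈PM ] (supp v)
  IsPosetVector⇔IsOrderIdeal v = DownClosed⇔IsOrderIdeal v ⇔-∘ mk⇔
    (λ p → ^-IsNLMatrix⇒DownClosed (PM⇒IsNLMatrix p))
    (λ dc → IsNLMatrix⇒PM (DownClosed⇒^-IsNLMatrix (PM⇒IsNLMatrix A∈PM) dc))

  private
    ideal : (v : Vec Bit n) → IsPosetVector A v → IsOrderIdeal P[ A∈PM ] (supp v)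
    ideal v = Equivalence.to (IsPosetVector⇔IsOrderIdeal v)

  indicator-IsPosetVector : (I : Subset n) → IsOrderIdeal P[ A∈PM ] I → IsPosetVector A (indicator I)
  indicator-IsPosetVector I I-ideal = Equivalence.from (IsPosetVector⇔IsOrderIdeal (indicator I))
    (subst (IsOrderIdeal P[ A∈PM ]) (sym (supp-indicator I)) I-ideal)

  vectors⤖ideals : Bijection (PosetVectors A) (OrderIdeals P[ A∈PM ])
  vectors⤖ideals = record
    { to        = λ (v , p) → supp v , ideal v p
    ; cong      = cong supp
    ; bijective = supp-injective
                -- Surjectivity asks that every vector equal to the chosen preimage map to `I`;
                -- hence the argument `eq`.
                , λ (I , I-ideal) → (indicator I , indicator-IsPosetVector I I-ideal)
                                  , λ eq → trans (cong supp eq) (supp-indicator I)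
    }

  vectors⤖extensions : Bijection (PosetVectors A) (PosetExtensions A)
  vectors⤖extensions = record
    { to        = λ (v , p) → A ^ v , v , p , refl
    ; cong      = cong (A ^_)
    ; bijective = ^-injective A
                , λ (B , v , p , B≡) → (v , p) , λ eq → trans (cong (A ^_) eq) (sym B≡)
    }

  -- The map uses the vector stored in the witness, while equality of extensions compares only
  -- matrices. `^-injective` shows that the stored vector is determined by the matrix.
  extensions⤖ideals : Bijection (PosetExtensions A) (OrderIdeals P[ A∈PM ])
  extensions⤖ideals = record
    { to        = λ (B , v , p , B≡) → supp v , ideal v p
    ; cong      = λ {(_ , _ , _ , B≡)} {(_ , _ , _ , C≡)} eq →
                    cong supp (^-injective A (trans (sym B≡) (trans eq C≡)))
    ; bijective = (λ {(_ , _ , _ , B≡)} {(_ , _ , _ , C≡)} eq →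
                    trans B≡ (trans (cong (A ^_) (supp-injective eq)) (sym C≡)))
                , λ (I , I-ideal) →
                    (A ^ indicator I , indicator I , indicator-IsPosetVector I I-ideal , refl)
                  , λ {(_ , _ , _ , B≡)} eq →
                      trans (cong supp (^-injective A (trans (sym B≡) eq))) (supp-indicator I)
    }

theorem2p1 : (n : ℕ) (A : Matrix n n) (A∈PM : PM n A) →
    ((v : Vec Bit n) → IsPosetVector A v ⇔ IsOrderIdeal P[ A∈PM ] (supp v))
    -- v ↦ supp v is a bijection from poset vectors to order ideals
    × (Σ[ f ∈ Bijection (PosetVectors A) (OrderIdeals P[ A∈PM ]) ]
         (∀ v → proj₁ (Bijection.to f v) ≡ supp (proj₁ v)))
    -- "equivalently": v ↦ A ^ v identifies poset vectors with extensions,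
    × (Σ[ g ∈ Bijection (PosetVectors A) (PosetExtensions A) ]
         (∀ v → proj₁ (Bijection.to g v) ≡ A ^ proj₁ v))
    -- and A ^ v ↦ supp v is a bijection from extensions to order ideals
    × (Σ[ h ∈ Bijection (PosetExtensions A) (OrderIdeals P[ A∈PM ]) ]
         (∀ B v → proj₁ B ≡ A ^ v → proj₁ (Bijection.to h B) ≡ supp v))
theorem2p1 n A A∈PM =
    IsPosetVector⇔IsOrderIdeal A∈PM
  , (vectors⤖ideals A∈PM , λ _ → refl)
  , (vectors⤖extensions A∈PM , λ _ → refl)
  , (extensions⤖ideals A∈PM
    -- The vector stored with the extension and the given one agree, since both extend `A` to the
    -- same matrix.
    , λ (_ , _ , _ , B≡) _ eq → cong supp (^-injective A (trans (sym B≡) eq)))
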